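{- Every countable model $\langle M,\in^M\rangle$ of set theory is universal for all countable $\mathrm{Ord}^M$-graded binary relations: if $\langle G,\rightharpoonup\rangle$ is a countable $\mathrm{Ord}^M$-graded digraph, then $\langle G,\rightharpoonup\rangle$ is isomorphic to a submodel of $\langle M,\in^M\rangle$.
   Context: A model of set theory is a first-order structure $\langle M,\in^M\rangle$ satisfying at least the Kripke–Platek axioms KP of set theory; it need not be well-founded. $\mathrm{Ord}^M$ is the linear order of the ordinals of $M$ (possibly ill-founded). A digraph $\langle G,\rightharpoonup\rangle$ is a set $G$ with a binary relation $\rightharpoonup$. For a linear order $\ell$, a digraph is $\ell$-graded if each $v\in G$ is assigned a value $\alpha_v\in\ell$ such that $v\rightharpoonup w$ implies $\alpha_v<\alpha_w$. The grading is external, and the isomorphism is of digraphs only. A submodel is an arbitrary subset with the restricted relation (an induced substructure). -}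

module Defs where

open import Data.Empty using (⊥)
open import Data.Fin using (Fin; zero; suc)
open import Data.Nat using (ℕ; suc)
open import Data.Product using (Σ; ∃; ∃-syntax; _×_; proj₁)
open import Data.Sum using (_⊎_)
open import Data.Vec using (Vec; _∷_; lookup)
open import Function.Base using (_on_)
open import Function.Bundles using (_↣_; _⇔_)
open import Level using (0ℓ)
open import Relation.Binary.Core using (Rel; _=[_]⇒_)
open import Relation.Binary.Morphism.Structures using (IsOrderIsomorphism)
open import Relation.Binary.PropositionalEquality using (_≡_)
open import Relation.Nullary using (¬_)
open import Relation.Unary using (Pred)

-- First-order formulas in the language {∈, =} with n free variables
-- (de Bruijn indices; a quantifier binds the variable zero).

infix  8 _∈̇_ _≐_
infixr 7 _∧̇_
infixr 6 _∨̇_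
infixr 5 _⇒̇_

data Formula (n : ℕ) : Set where
  ⊥̇              : Formula n
  _∈̇_ _≐_        : (x y : Fin n) → Formula n
  _∧̇_ _∨̇_ _⇒̇_   : (φ ψ : Formula n) → Formula n
  ∀̇_ ∃̇_          : (φ : Formula (suc n)) → Formula n

-- In the bounded quantifiers the bound y is a variable of the context
-- outside the quantifier, hence distinct from the bound variable.

data Δ₀ {n : ℕ} : Formula n → Set where
  bot  : Δ₀ ⊥̇
  mem  : ∀ x y → Δ₀ (x ∈̇ y)
  eq   : ∀ x y → Δ₀ (x ≐ y)
  and  : ∀ {φ ψ} → Δ₀ φ → Δ₀ ψ → Δ₀ (φ ∧̇ ψ)
  or   : ∀ {φ ψ} → Δ₀ φ → Δ₀ ψ → Δ₀ (φ ∨̇ ψ)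
  imp  : ∀ {φ ψ} → Δ₀ φ → Δ₀ ψ → Δ₀ (φ ⇒̇ ψ)
  all∈ : ∀ y {φ} → Δ₀ φ → Δ₀ (∀̇ (zero ∈̇ suc y ⇒̇ φ))
  ex∈  : ∀ y {φ} → Δ₀ φ → Δ₀ (∃̇ (zero ∈̇ suc y ∧̇ φ))

module _ {M : Set} (_∈_ : Rel M 0ℓ) where

  Sat : ∀ {n} → Formula n → Vec M n → Set
  Sat ⊥̇        ρ = ⊥
  Sat (x ∈̇ y)  ρ = lookup ρ x ∈ lookup ρ y
  Sat (x ≐ y)  ρ = lookup ρ x ≡ lookup ρ y
  Sat (φ ∧̇ ψ)  ρ = Sat φ ρ × Sat ψ ρ
  Sat (φ ∨̇ ψ)  ρ = Sat φ ρ ⊎ Sat ψ ρ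
  Sat (φ ⇒̇ ψ)  ρ = Sat φ ρ → Sat ψ ρ
  Sat (∀̇ φ)    ρ = ∀ m → Sat φ (m ∷ ρ)
  Sat (∃̇ φ)    ρ = ∃[ m ] Sat φ (m ∷ ρ)

  -- Each field is the Tarskian meaning in (M , ∈) of the axiom it names.
  -- In the schemes ρ lists the parameters of φ.  Foundation is the full
  -- scheme of ∈-induction, and Infinity is one of the axioms: without it
  -- the hereditarily finite sets would be a model whose elements have
  -- only finitely many ∈-predecessors.

  record IsKPModel : Set where
    field
      extensionality : ∀ a b → (∀ x → x ∈ a ⇔ x ∈ b) → a ≡ b
      pairing        : ∀ a b → ∃[ c ] ∀ x → x ∈ c ⇔ (x ≡ a ⊎ x ≡ b)
      union          : ∀ a → ∃[ u ] ∀ x → x ∈ u ⇔ (∃[ y ] y ∈ a × x ∈ y)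
      infinity       : ∃[ w ] (∃[ e ] e ∈ w × (∀ x → ¬ (x ∈ e)))
                            × (∀ x → x ∈ w →
                                 ∃[ s ] s ∈ w × (∀ z → z ∈ s ⇔ (z ∈ x ⊎ z ≡ x)))
      foundation     : ∀ {n} (φ : Formula (suc n)) (ρ : Vec M n) →
                       (∀ x → (∀ y → y ∈ x → Sat φ (y ∷ ρ)) → Sat φ (x ∷ ρ)) →
                       ∀ x → Sat φ (x ∷ ρ)
      Δ₀-separation  : ∀ {n} (φ : Formula (suc n)) → Δ₀ φ → (ρ : Vec M n) →
                       ∀ a → ∃[ b ] ∀ x → x ∈ b ⇔ (x ∈ a × Sat φ (x ∷ ρ))
      Δ₀-collection  : ∀ {n} (φ : Formula (suc (suc n))) → Δ₀ φ → (ρ : Vec M n) →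
                       ∀ a → (∀ x → x ∈ a → ∃[ y ] Sat φ (y ∷ x ∷ ρ)) →
                       ∃[ b ] ∀ x → x ∈ a → ∃[ y ] y ∈ b × Sat φ (y ∷ x ∷ ρ)

  TransitiveSet : Pred M 0ℓ
  TransitiveSet a = ∀ x → x ∈ a → ∀ y → y ∈ x → y ∈ a

  -- Over KP, the ordinals are the transitive sets of transitive sets.

  IsOrdinal : Pred M 0ℓ
  IsOrdinal a = TransitiveSet a × (∀ x → x ∈ a → TransitiveSet x)

  Ord : Set
  Ord = Σ M IsOrdinal

  _<ᴼ_ : Rel Ord 0ℓ
  _<ᴼ_ = _∈_ on proj₁

Countable : Set → Set
Countable A = A ↣ ℕ

Grading : {L G : Set} → Rel L 0ℓ → Rel G 0ℓ → Set
Grading {L} {G} _<_ _⇀_ = ∃[ α ] (_⇀_ =[ α ]⇒ _<_)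

-- The submodel on N ⊆ M has carrier Σ M N.  Its equality is that of M, so
-- distinct proofs of membership in N do not give distinct elements.

IsomorphicToSubmodel : {G M : Set} → Rel G 0ℓ → Rel M 0ℓ → Set₁
IsomorphicToSubmodel {G} {M} _⇀_ _∈_ =
  Σ (Pred M 0ℓ) λ N → Σ (G → Σ M N) λ j →
    IsOrderIsomorphism _≡_ (_≡_ on proj₁) _⇀_ (_∈_ on proj₁) j

-- Fix an enumeration of G, and code a vertex v of index i by the finite set
-- s_v ∈ M of a marker W, the numeral i and the numerals k < i whose vertices
-- are joined to v by an arrow in either direction.  Two codes are adjacent if the
-- greatest numeral of one lies in the other, so v and w are joined exactly when
-- s_v and s_w are adjacent.  By ∈-recursion in M, for a ∈ M and a code s, let
--   x(s,a) = {s, {{a}}} ∪ {x(s′,a′) : a′ ∈ a, s′ adjacent to s}.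
-- Then v ↦ x(s_v,α_v) is an embedding: the grading gives the direction of the
-- arrows, and s, {{a}} are recovered from x(s,a), hence injectivity.
-- KP needs no powerset for this: some set contains all the codes, because by
-- induction on a natural number n some set contains {W} and is closed under
-- y ↦ y ∪ {m} for m < n, and these sets can be collected over n.
module Submission where

open import Defs
open import Axiom.ExcludedMiddle using (ExcludedMiddle)
open import Data.Empty using (⊥-elim)
open import Data.Fin using (Fin; zero; suc; _↑ʳ_)
open import Data.Nat using (ℕ; zero; suc; _<_; _≤_; s≤s)
open import Data.Nat.Properties
  using (≤-refl; ≤-total; <-cmp; m<1+n⇒m<n∨m≡n; m≤n⇒m<n∨m≡n; m≤n⇒m≤1+n; n≮0)
open import Data.Product using (∃; ∃-syntax; _×_; _,_; proj₁; proj₂)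
open import Data.Sum using (_⊎_; inj₁; inj₂; [_,_]′; map₂)
open import Data.Vec using (Vec; []; _∷_)
open import Function.Base using (_∘_; id)
open import Function.Bundles using (_⇔_; mk⇔; Equivalence; Injection)
open import Level using (0ℓ)
open import Relation.Binary.Core using (Rel)
open import Relation.Binary.Definitions using (tri<; tri≈; tri>)
open import Relation.Binary.PropositionalEquality
  using (_≡_; refl; sym; trans; cong; subst)
open import Relation.Nullary using (¬_; yes; no)

open Equivalence using (to; from)

-- Bounded formulas for the schemes of KP

BoundedFormula : ℕ → Set
BoundedFormula n = ∃ (Δ₀ {n})

private
  variable
    n : ℕ

pattern v0 = zero
pattern v1 = suc v0
pattern v2 = suc v1
pattern v3 = suc v2
pattern v4 = suc v3
pattern v5 = suc v4
pattern v6 = suc v5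

infix  8 _∈ᵇ_ _≐ᵇ_
infixr 7 _∧ᵇ_
infixr 6 _∨ᵇ_
infixr 5 _⇒ᵇ_

⊥ᵇ : BoundedFormula n
⊥ᵇ = _ , bot

_∈ᵇ_ _≐ᵇ_ : Fin n → Fin n → BoundedFormula n
x ∈ᵇ y = _ , mem x y
x ≐ᵇ y = _ , eq x y

_∧ᵇ_ _∨ᵇ_ _⇒ᵇ_ : BoundedFormula n → BoundedFormula n → BoundedFormula n
(_ , p) ∧ᵇ (_ , q) = _ , and p q
(_ , p) ∨ᵇ (_ , q) = _ , or p q
(_ , p) ⇒ᵇ (_ , q) = _ , imp p q

∀∈ᵇ ∃∈ᵇ : Fin n → BoundedFormula (suc n) → BoundedFormula n
∀∈ᵇ y (_ , p) = _ , all∈ y p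
∃∈ᵇ y (_ , p) = _ , ex∈ y p

-- From here on each formula unfolds under `Sat` to the capitalised predicate of the same name, so
-- the schemes apply to these predicates without any translation.
singletonᵇ : (l a : Fin n) → BoundedFormula n
singletonᵇ l a = a ∈ᵇ l ∧ᵇ ∀∈ᵇ l (v0 ≐ᵇ suc a)

adjunctionᵇ : (z y m : Fin n) → BoundedFormula n
adjunctionᵇ z y m =
  m ∈ᵇ z ∧ᵇ ∀∈ᵇ y (v0 ∈ᵇ suc z) ∧ᵇ ∀∈ᵇ z (v0 ∈ᵇ suc y ∨ᵇ v0 ≐ᵇ suc m)

zeroOrSuccᵇ : Fin n → BoundedFormula n
zeroOrSuccᵇ m = ∀∈ᵇ m ⊥ᵇ ∨ᵇ ∃∈ᵇ m (adjunctionᵇ (suc m) v0 v0)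

naturalᵇ : Fin n → BoundedFormula n
naturalᵇ m = zeroOrSuccᵇ m ∧ᵇ ∀∈ᵇ m (zeroOrSuccᵇ v0)

closedᵇ : (W m P : Fin n) → BoundedFormula n
closedᵇ W m P =
  ∃∈ᵇ P (singletonᵇ v0 (suc W)) ∧ᵇ
  ∀∈ᵇ P (∀∈ᵇ (1 ↑ʳ m) (∃∈ᵇ (2 ↑ʳ P) (adjunctionᵇ v0 v2 v1)))

codeᵇ : (W s : Fin n) → BoundedFormula n
codeᵇ W s =
  W ∈ᵇ s ∧ᵇ ∀∈ᵇ s (v0 ∈ᵇ suc W ∨ᵇ v0 ≐ᵇ suc W) ∧ᵇ ∃∈ᵇ s (v0 ∈ᵇ suc W)

topᵇ : (W m s : Fin n) → BoundedFormula n
topᵇ W m s = ∀∈ᵇ s (v0 ∈ᵇ suc m ∨ᵇ v0 ≐ᵇ suc m ∨ᵇ v0 ≐ᵇ suc W)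

adjacentᵇ : (W s′ s : Fin n) → BoundedFormula n
adjacentᵇ W s′ s =
  ∃∈ᵇ s′ (v0 ∈ᵇ suc s ∧ᵇ v0 ∈ᵇ suc W ∧ᵇ
          (topᵇ (suc W) v0 (suc s′) ∨ᵇ topᵇ (suc W) v0 (suc s)))

labelᵇ : (l a : Fin n) → BoundedFormula n
labelᵇ l a = ∃∈ᵇ l (singletonᵇ v0 (suc a) ∧ᵇ singletonᵇ (suc l) v0)

indexedᵇ : (K x s a : Fin n) → BoundedFormula n
indexedᵇ K x s a = s ∈ᵇ x ∧ᵇ s ∈ᵇ K ∧ᵇ ∃∈ᵇ x (labelᵇ v0 (suc a))

belowᵇ : (W K y s a : Fin n) → BoundedFormula n
belowᵇ W K y s a =
  ∃∈ᵇ y (∃∈ᵇ (1 ↑ʳ a) (indexedᵇ (2 ↑ʳ K) (2 ↑ʳ y) v1 v0 ∧ᵇ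
                       adjacentᵇ (2 ↑ʳ W) v1 (2 ↑ʳ s)))

onlyBelowᵇ completeᵇ : (W K f x s a : Fin n) → BoundedFormula n
onlyBelowᵇ W K f x s a =
  ∀∈ᵇ x (v0 ≐ᵇ suc s ∨ᵇ labelᵇ v0 (suc a) ∨ᵇ
         (v0 ∈ᵇ suc f ∧ᵇ belowᵇ (suc W) (suc K) v0 (suc s) (suc a)))
completeᵇ W K f x s a =
  ∀∈ᵇ a (∀∈ᵇ (1 ↑ʳ K) (adjacentᵇ (2 ↑ʳ W) v0 (2 ↑ʳ s) ⇒ᵇ
    ∃∈ᵇ (2 ↑ʳ x) (v0 ∈ᵇ (3 ↑ʳ f) ∧ᵇ indexedᵇ (3 ↑ʳ K) v0 v1 v2)))

attemptᵇ : (W K f : Fin n) → BoundedFormula n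
attemptᵇ W K f =
  ∀∈ᵇ f (∀∈ᵇ v0 (v0 ∈ᵇ (2 ↑ʳ K) ⇒ᵇ ∀∈ᵇ v1 (∀∈ᵇ v0 (∀∈ᵇ v0 (labelᵇ v2 v0 ⇒ᵇ
    (onlyBelowᵇ (5 ↑ʳ W) (5 ↑ʳ K) (5 ↑ʳ f) v4 v3 v0 ∧ᵇ
     completeᵇ (5 ↑ʳ W) (5 ↑ʳ K) (5 ↑ʳ f) v4 v3 v0))))))

coversᵇ : (W K f a : Fin n) → BoundedFormula n
coversᵇ W K f a =
  attemptᵇ W K f ∧ᵇ ∀∈ᵇ K (∃∈ᵇ (1 ↑ʳ f) (indexedᵇ (2 ↑ʳ K) v0 v1 (2 ↑ʳ a)))

vertexᵇ : (W K F x s a : Fin n) → BoundedFormula n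
vertexᵇ W K F x s a =
  indexedᵇ K x s a ∧ᵇ onlyBelowᵇ W K F x s a ∧ᵇ
  ∀∈ᵇ F (belowᵇ (suc W) (suc K) v0 (suc s) (suc a) ⇒ᵇ v0 ∈ᵇ suc x)

-- Elementary set theory in a model of KP

module KP (em : ExcludedMiddle 0ℓ) {M : Set} (_∈_ : Rel M 0ℓ) (kp : IsKPModel _∈_) where
  open IsKPModel kp

  infix 4 _∉_
  _∉_ : Rel M 0ℓ
  x ∉ y = ¬ (x ∈ y)

  ⟦_⟧ : BoundedFormula n → Vec M n → Set
  ⟦ φ ⟧ = Sat _∈_ (proj₁ φ)

  separation : (φ : BoundedFormula (suc n)) (ρ : Vec M n) (a : M) →
               ∃[ b ] ∀ x → x ∈ b ⇔ (x ∈ a × ⟦ φ ⟧ (x ∷ ρ))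
  separation (φ , p) = Δ₀-separation φ p

  collection : (φ : BoundedFormula (suc (suc n))) (ρ : Vec M n) (a : M) →
               (∀ x → x ∈ a → ∃[ y ] ⟦ φ ⟧ (y ∷ x ∷ ρ)) →
               ∃[ b ] ∀ x → x ∈ a → ∃[ y ] y ∈ b × ⟦ φ ⟧ (y ∷ x ∷ ρ)
  collection (φ , p) = Δ₀-collection φ p

  -- ψ is φ with its first two variables interchanged.
  strong-collection :
    (φ : BoundedFormula (suc (suc n))) (ψ : BoundedFormula (suc (suc (suc n))))
    (ρ : Vec M n) (a : M) →
    (∀ x y → ⟦ φ ⟧ (y ∷ x ∷ ρ) ≡ ⟦ ψ ⟧ (x ∷ y ∷ a ∷ ρ)) →
    (∀ x → x ∈ a → ∃[ y ] ⟦ φ ⟧ (y ∷ x ∷ ρ)) →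
    ∃[ b ] (∀ x → x ∈ a → ∃[ y ] y ∈ b × ⟦ φ ⟧ (y ∷ x ∷ ρ)) ×
           (∀ y → y ∈ b → ∃[ x ] x ∈ a × ⟦ φ ⟧ (y ∷ x ∷ ρ))
  strong-collection φ ψ ρ a swap total
    with b , collects ← collection φ ρ a total
    with c , c-spec ← separation (∃∈ᵇ v1 ψ) (a ∷ ρ) b
    = c
    , (λ x x∈a → let y , y∈b , p = collects x x∈a in
        y , from (c-spec y) (y∈b , x , x∈a , subst id (swap x y) p) , p)
    , (λ y y∈c → let _ , x , x∈a , p = to (c-spec y) y∈c in
        x , x∈a , subst id (sym (swap x y)) p)

  ∈-asym : ∀ x y → y ∈ x → x ∉ y
  ∈-asym = foundation (∀̇ (v0 ∈̇ v1 ⇒̇ v1 ∈̇ v0 ⇒̇ ⊥̇)) []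
    λ x ih y y∈x x∈y → ih y y∈x x x∈y y∈x

  ∈-irrefl : ∀ {x y} → x ≡ y → x ∉ y
  ∈-irrefl refl x∈x = ∈-asym _ _ x∈x x∈x

  _∪_ : (a b : M) → ∃[ c ] ∀ x → x ∈ c ⇔ (x ∈ a ⊎ x ∈ b)
  a ∪ b with p , p-spec ← pairing a b with c , c-spec ← union p = c , λ x → mk⇔
    (λ x∈c → case-of x (to (c-spec x) x∈c))
    [ (λ x∈a → from (c-spec x) (a , from (p-spec a) (inj₁ refl) , x∈a))
    , (λ x∈b → from (c-spec x) (b , from (p-spec b) (inj₂ refl) , x∈b)) ]′
    where
    case-of : ∀ x → ∃[ y ] y ∈ p × x ∈ y → x ∈ a ⊎ x ∈ b
    case-of x (y , y∈p , x∈y) with to (p-spec y) y∈p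
    ... | inj₁ refl = inj₁ x∈y
    ... | inj₂ refl = inj₂ x∈y

  Singleton : Rel M 0ℓ
  Singleton l a = a ∈ l × (∀ z → z ∈ l → z ≡ a)

  singleton : ∀ a → ∃[ l ] Singleton l a
  singleton a with l , l-spec ← pairing a a =
    l , from (l-spec a) (inj₁ refl) , λ z z∈l → [ id , id ]′ (to (l-spec z) z∈l)

  singleton-unique : ∀ {l l′ a} → Singleton l a → Singleton l′ a → l ≡ l′
  singleton-unique (a∈l , only) (a∈l′ , only′) = extensionality _ _ λ x → mk⇔
    (λ x∈l → subst (_∈ _) (sym (only x x∈l)) a∈l′)
    (λ x∈l′ → subst (_∈ _) (sym (only′ x x∈l′)) a∈l)

  singleton-injective : ∀ {l a b} → Singleton l a → Singleton l b → a ≡ b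
  singleton-injective (a∈l , _) (_ , only) = only _ a∈l

  Adjunction : M → M → M → Set
  Adjunction z y m = m ∈ z × (∀ u → u ∈ y → u ∈ z) × (∀ u → u ∈ z → u ∈ y ⊎ u ≡ m)

  adjunction : ∀ y m → ∃[ z ] Adjunction z y m
  adjunction y m
    with l , m∈l , only ← singleton m
    with z , z-spec ← y ∪ l
    = z , from (z-spec m) (inj₂ m∈l) , (λ u → from (z-spec u) ∘ inj₁)
    , λ u u∈z → map₂ (only u) (to (z-spec u) u∈z)

  -- The double singleton {{a}} is distinguishable from every set with two elements.
  Label : Rel M 0ℓ
  Label l a = ∃[ t ] t ∈ l × Singleton t a × Singleton l t

  label : ∀ a → ∃[ l ] Label l a
  label a with t , t≡[a] ← singleton a with l , l≡[t] ← singleton t =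
    l , t , proj₁ l≡[t] , t≡[a] , l≡[t]

  label-unique : ∀ {l l′ a} → Label l a → Label l′ a → l ≡ l′
  label-unique (t , _ , t≡[a] , l≡[t]) (t′ , _ , t′≡[a] , l′≡[t′])
    with refl ← singleton-unique t≡[a] t′≡[a] = singleton-unique l≡[t] l′≡[t′]

  label-injective : ∀ {l a b} → Label l a → Label l b → a ≡ b
  label-injective (_ , _ , t≡[a] , l≡[t]) (_ , _ , t′≡[b] , l≡[t′])
    with refl ← singleton-injective l≡[t] l≡[t′] = singleton-injective t≡[a] t′≡[b]

  -- Natural numbers of `M` and standard numerals

  ZeroOrSucc : M → Set
  ZeroOrSucc m = (∀ z → z ∉ m) ⊎ ∃[ p ] p ∈ m × Adjunction m p p

  -- A bounded description of the natural numbers in the sense of `M`, nonstandard ones included.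
  Natural : M → Set
  Natural m = ZeroOrSucc m × (∀ p → p ∈ m → ZeroOrSucc p)

  -- Any inductive set will do; `W` may have elements other than the numerals `# k`, which are
  -- chosen by recursion outside `M`.
  W : M
  W = proj₁ infinity

  num : ℕ → ∃[ x ] x ∈ W
  num zero = let e , e∈W , _ = proj₁ (proj₂ infinity) in e , e∈W
  num (suc k) =
    let s , s∈W , _ = proj₂ (proj₂ infinity) (proj₁ (num k)) (proj₂ (num k)) in s , s∈W

  # : ℕ → M
  # = proj₁ ∘ num

  ∉-#0 : ∀ z → z ∉ # 0
  ∉-#0 = let _ , _ , empty = proj₁ (proj₂ infinity) in empty

  ∈-#suc : ∀ k z → z ∈ # (suc k) ⇔ (z ∈ # k ⊎ z ≡ # k)
  ∈-#suc k =
    let _ , _ , spec = proj₂ (proj₂ infinity) (proj₁ (num k)) (proj₂ (num k)) in spec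

  #≢W : ∀ k → ¬ # k ≡ W
  #≢W k #k≡W = ∈-irrefl #k≡W (proj₂ (num k))

  #-mono : ∀ {l k} → l < k → # l ∈ # k
  #-mono {k = zero} l<0 = ⊥-elim (n≮0 l<0)
  #-mono {k = suc k} l<1+k with m<1+n⇒m<n∨m≡n l<1+k
  ... | inj₁ l<k = from (∈-#suc k _) (inj₁ (#-mono l<k))
  ... | inj₂ refl = from (∈-#suc k _) (inj₂ refl)

  #-injective : ∀ {l k} → # l ≡ # k → l ≡ k
  #-injective {l} {k} #l≡#k with <-cmp l k
  ... | tri< l<k _ _ = ⊥-elim (∈-irrefl #l≡#k (#-mono l<k))
  ... | tri≈ _ l≡k _ = l≡k
  ... | tri> _ _ k<l = ⊥-elim (∈-irrefl (sym #l≡#k) (#-mono k<l))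

  #-∈⇒≱ : ∀ {l k} → # l ∈ # k → ¬ k ≤ l
  #-∈⇒≱ #l∈#k k≤l with m≤n⇒m<n∨m≡n k≤l
  ... | inj₁ k<l = ∈-asym _ _ #l∈#k (#-mono k<l)
  ... | inj₂ refl = ∈-irrefl refl #l∈#k

  #-natural : ∀ k → Natural (# k)
  #-natural k = #-zeroOrSucc k , members k
    where
    #-zeroOrSucc : ∀ k → ZeroOrSucc (# k)
    #-zeroOrSucc zero = inj₁ ∉-#0
    #-zeroOrSucc (suc k) = inj₂
      (# k , #k∈ , #k∈ , (λ z → from (∈-#suc k z) ∘ inj₁) , λ z → to (∈-#suc k z))
      where
      #k∈ : # k ∈ # (suc k)
      #k∈ = from (∈-#suc k _) (inj₂ refl)

    members : ∀ k p → p ∈ # k → ZeroOrSucc p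
    members zero p p∈ = ⊥-elim (∉-#0 p p∈)
    members (suc k) p p∈ with to (∈-#suc k p) p∈
    ... | inj₁ p∈#k = members k p p∈#k
    ... | inj₂ refl = #-zeroOrSucc k

  -- A set containing all codes

  Closed : Rel M 0ℓ
  Closed m P = (∃[ z ] z ∈ P × Singleton z W) ×
               (∀ y → y ∈ P → ∀ u → u ∈ m → ∃[ z ] z ∈ P × Adjunction z y u)

  closed-zero : ∀ {m} → (∀ z → z ∉ m) → ∃ (Closed m)
  closed-zero empty
    with z , z≡[W] ← singleton W
    with P , z∈P , _ ← singleton z
    = P , (z , z∈P , z≡[W]) , λ _ _ u u∈m → ⊥-elim (empty u u∈m)

  -- `P` is enlarged by Q = { y ∪ {p} : y ∈ P }. This suffices because adjunctions commute and
  -- repeating one changes nothing.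
  closed-suc : ∀ {m p} → Adjunction m p p → ∃ (Closed p) → ∃ (Closed m)
  closed-suc {m} {p} (_ , _ , m-split) (P , (z , z∈P , z≡[W]) , close)
    with Q , Q-total , Q-only ← strong-collection
           (adjunctionᵇ v0 v1 v2) (adjunctionᵇ v1 v0 v3) (p ∷ []) P
           (λ _ _ → refl) (λ y _ → adjunction y p)
    with R , R-spec ← P ∪ Q
    = R , (z , from (R-spec z) (inj₁ z∈P) , z≡[W]) , closes
    where
    closes : ∀ y → y ∈ R → ∀ u → u ∈ m → ∃[ z ] z ∈ R × Adjunction z y u
    closes y y∈R u u∈m with to (R-spec y) y∈R | m-split u u∈m
    ... | inj₁ y∈P | inj₁ u∈p =
      let z , z∈P , adj = close y y∈P u u∈p in z , from (R-spec z) (inj₁ z∈P) , adj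
    ... | inj₁ y∈P | inj₂ refl =
      let z , z∈Q , adj = Q-total y y∈P in z , from (R-spec z) (inj₂ z∈Q) , adj
    ... | inj₂ y∈Q | inj₂ refl =
      let _ , _ , p∈y , _ = Q-only y y∈Q in y , y∈R , p∈y , (λ _ → id) , λ _ → inj₁
    -- Here y = y₀ ∪ {p}, and the witness is (y₀ ∪ {u}) ∪ {p}.
    ... | inj₂ y∈Q | inj₁ u∈p
      with y₀ , y₀∈P , p∈y , y₀⊆y , y-split ← Q-only y y∈Q
      with z₀ , z₀∈P , u∈z₀ , y₀⊆z₀ , z₀-split ← close y₀ y₀∈P u u∈p
      with z , z∈Q , p∈z , z₀⊆z , z-split ← Q-total z₀ z₀∈P
      = z , from (R-spec z) (inj₂ z∈Q) , z₀⊆z u u∈z₀ , y⊆z , z⊆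
      where
      y⊆z : ∀ x → x ∈ y → x ∈ z
      y⊆z x x∈y with y-split x x∈y
      ... | inj₁ x∈y₀ = z₀⊆z x (y₀⊆z₀ x x∈y₀)
      ... | inj₂ refl = p∈z

      z⊆ : ∀ x → x ∈ z → x ∈ y ⊎ x ≡ u
      z⊆ x x∈z with z-split x x∈z
      ... | inj₂ refl = inj₁ p∈y
      ... | inj₁ x∈z₀ with z₀-split x x∈z₀
      ...   | inj₁ x∈y₀ = inj₁ (y₀⊆y x x∈y₀)
      ...   | inj₂ x≡u = inj₂ x≡u

  closed : ∀ m → Natural m → ∃ (Closed m)
  -- The quantifier over `P` is unbounded, so this uses ∈-induction for a formula that is not Δ₀.
  closed = foundation
    (proj₁ (naturalᵇ v0) ⇒̇ (∃̇ (proj₁ (closedᵇ v2 v1 v0)))) (W ∷ []) step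
    where
    step : ∀ m → (∀ p → p ∈ m → Natural p → ∃ (Closed p)) → Natural m → ∃ (Closed m)
    step m _ (inj₁ empty , _) = closed-zero empty
    step m ih (inj₂ (p , p∈m , m≡p+1@(_ , p⊆m , _)) , nat) = closed-suc m≡p+1
      (ih p p∈m (nat p p∈m , λ q q∈p → nat q (p⊆m q q∈p)))

  -- The marker W makes codes ∈-incomparable (a code is never an element of a
  -- numeral), and as a second element makes them differ from {a} and {{a}}.
  Code : M → Set
  Code s = W ∈ s × (∀ z → z ∈ s → z ∈ W ⊎ z ≡ W) × (∃[ z ] z ∈ s × z ∈ W)

  code-∉ : ∀ {s s′} → Code s → Code s′ → s′ ∉ s
  code-∉ (_ , s⊆ , _) (W∈s′ , _ , _) s′∈s with s⊆ _ s′∈s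
  ... | inj₁ s′∈W = ∈-asym _ _ s′∈W W∈s′
  ... | inj₂ s′≡W = ∈-irrefl (sym s′≡W) W∈s′

  code-¬singleton : ∀ {s a} → Code s → ¬ Singleton s a
  code-¬singleton (W∈s , _ , z , z∈s , z∈W) (_ , only) =
    ∈-irrefl (trans (only z z∈s) (sym (only W W∈s))) z∈W

  code-¬label : ∀ {s a} → Code s → ¬ Label s a
  code-¬label code (_ , _ , _ , single) = code-¬singleton code single

  code-∉label : ∀ {s l a} → Code s → Label l a → s ∉ l
  code-∉label code (t , _ , t≡[a] , (_ , only)) s∈l
    with refl ← only _ s∈l = code-¬singleton code t≡[a]

  Codes : ℕ → (ℕ → Set) → M → Set
  Codes k A s = ∀ z → z ∈ s ⇔ (z ≡ W ⊎ ∃[ l ] l < k × A l × z ≡ # l)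

  -- Induction on `k` outside `M`: excluded middle decides `A k`, and `# k` is adjoined or not. Thus
  -- even a predicate not definable in `M` is coded below a standard bound.
  closed⇒codes : ∀ {m P} → Closed m P → ∀ A k → (∀ {l} → l < k → # l ∈ m) →
                 ∃[ s ] s ∈ P × Codes k A s
  closed⇒codes ((z , z∈P , (W∈z , only)) , _) A zero _ = z , z∈P , λ x → mk⇔
    (inj₁ ∘ only x)
    λ { (inj₁ refl) → W∈z ; (inj₂ (_ , l<0 , _)) → ⊥-elim (n≮0 l<0) }
  closed⇒codes C@(_ , close) A (suc k) ⊆m
    with s , s∈P , s-spec ← closed⇒codes C A k (⊆m ∘ m≤n⇒m≤1+n)
    with em {A k}
  ... | no ¬Ak = s , s∈P , λ x → mk⇔
    (map₂ (λ (l , l<k , rest) → l , m≤n⇒m≤1+n l<k , rest) ∘ to (s-spec x))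
    (from (s-spec x) ∘ map₂ λ (l , l<1+k , Al , x≡l) →
      l , [ id , (λ { refl → ⊥-elim (¬Ak Al) }) ]′ (m<1+n⇒m<n∨m≡n l<1+k) , Al , x≡l)
  ... | yes Ak
    with z , z∈P , k∈z , s⊆z , z-split ← close s s∈P (# k) (⊆m ≤-refl)
    = z , z∈P , λ x → mk⇔ (split x) (join x)
    where
    split : ∀ x → x ∈ z → x ≡ W ⊎ ∃[ l ] l < suc k × A l × x ≡ # l
    split x x∈z with z-split x x∈z
    ... | inj₁ x∈s = map₂ (λ (l , l<k , rest) → l , m≤n⇒m≤1+n l<k , rest) (to (s-spec x) x∈s)
    ... | inj₂ x≡k = inj₂ (k , ≤-refl , Ak , x≡k)

    join : ∀ x → (x ≡ W ⊎ ∃[ l ] l < suc k × A l × x ≡ # l) → x ∈ z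
    join x (inj₁ x≡W) = s⊆z x (from (s-spec x) (inj₁ x≡W))
    join x (inj₂ (l , l<1+k , Al , x≡l)) with m<1+n⇒m<n∨m≡n l<1+k
    ... | inj₁ l<k = s⊆z x (from (s-spec x) (inj₂ (l , l<k , Al , x≡l)))
    ... | inj₂ refl = subst (_∈ z) (sym x≡l) k∈z

  -- Collection over `W` needs a witness for every element; those that are not natural get the
  -- arbitrary value `m`.
  natural⇒closed : ∀ m → ∃[ P ] (Natural m → Closed m P)
  natural⇒closed m with em {Natural m}
  ... | yes nat = let P , P-closed = closed m nat in P , λ _ → P-closed
  ... | no ¬nat = m , ⊥-elim ∘ ¬nat

  abstract
    codes : ∃[ K ] (∀ s → s ∈ K → Code s) ×
                   (∀ A k → A k → ∃[ s ] s ∈ K × Codes (suc k) A s)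
    codes
      with b , b-spec ← collection (naturalᵇ v1 ⇒ᵇ closedᵇ v2 v1 v0) (W ∷ []) W
                            (λ m _ → natural⇒closed m)
      with u , u-spec ← union b
      with K , K-spec ← separation (codeᵇ v1 v0) (W ∷ []) u
      = K , (λ s → proj₂ ∘ to (K-spec s)) , λ A k Ak →
        -- A code with greatest numeral `# k` uses numerals with index below `suc k`, all of them
        -- elements of `# (suc k)`.
        let P , P∈b , P-closed = b-spec (# (suc k)) (proj₂ (num (suc k)))
            s , s∈P , s-spec =
              closed⇒codes (P-closed (#-natural (suc k))) A (suc k) #-mono
        in s , from (K-spec s) (from (u-spec s) (P , P∈b , s∈P)
             , from (s-spec W) (inj₁ refl)
             , (λ z z∈s → code-member A (suc k) z (to (s-spec z) z∈s))
             , # k , from (s-spec (# k)) (inj₂ (k , ≤-refl , Ak , refl)) , proj₂ (num k))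
           , s-spec
      where
      code-member : (A : ℕ → Set) → ∀ k z →
                    (z ≡ W ⊎ ∃[ l ] l < k × A l × z ≡ # l) → z ∈ W ⊎ z ≡ W
      code-member A k z (inj₁ z≡W) = inj₂ z≡W
      code-member A k z (inj₂ (l , _ , _ , refl)) = inj₁ (proj₂ (num l))

  -- Adjacency and the recursion in `M`

  Top : Rel M 0ℓ
  Top m s = ∀ z → z ∈ s → z ∈ m ⊎ z ≡ m ⊎ z ≡ W

  -- The clause `m ∈ W` excludes the marker, which lies in all codes and would make any two of them
  -- adjacent.
  Adjacent : Rel M 0ℓ
  Adjacent s′ s = ∃[ m ] m ∈ s′ × m ∈ s × m ∈ W × (Top m s′ ⊎ Top m s)

  module Recursion (K : M) (code : ∀ s → s ∈ K → Code s) where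

    Indexed : M → M → M → Set
    Indexed x s a = s ∈ x × s ∈ K × ∃[ l ] l ∈ x × Label l a

    Below : M → M → M → Set
    Below y s a = ∃[ s′ ] s′ ∈ y × ∃[ a′ ] a′ ∈ a × Indexed y s′ a′ × Adjacent s′ s

    -- The recursion equation for x(s,a), split in two: `x` has no other elements, and every
    -- required recursive value is present. The values are taken from `f`.
    OnlyBelow Complete : M → M → M → M → Set
    OnlyBelow f x s a =
      ∀ y → y ∈ x → y ≡ s ⊎ Label y a ⊎ (y ∈ f × Below y s a)
    Complete f x s a =
      ∀ a′ → a′ ∈ a → ∀ s′ → s′ ∈ K → Adjacent s′ s →
      ∃[ y ] y ∈ x × y ∈ f × Indexed y s′ a′

    -- Attempts are sets of vertices instead of functions (s , a) ↦ x: a vertex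
    -- carries its arguments as elements.  Hence a union of attempts is an attempt,
    -- with no compatibility condition.  (t only bounds the quantifier over a.)
    Attempt : M → Set
    Attempt f =
      ∀ x → x ∈ f → ∀ s → s ∈ x → s ∈ K → ∀ l → l ∈ x → ∀ t → t ∈ l → ∀ a → a ∈ t →
      Label l a → OnlyBelow f x s a × Complete f x s a

    Covers : Rel M 0ℓ
    Covers f a = Attempt f × (∀ s → s ∈ K → ∃[ x ] x ∈ f × Indexed x s a)

    Vertex : M → M → M → M → Set
    Vertex F x s a =
      Indexed x s a × OnlyBelow F x s a × (∀ y → y ∈ F → Below y s a → y ∈ x)

    attempt-correct : ∀ {f x s a} → Attempt f → x ∈ f → Indexed x s a →
                      OnlyBelow f x s a × Complete f x s a
    attempt-correct att x∈f (s∈x , s∈K , l , l∈x , lab@(t , t∈l , (a∈t , _) , _)) =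
      att _ x∈f _ s∈x s∈K l l∈x t t∈l _ a∈t lab

    -- Labels are singletons and recursive values contain a code, so neither can be a code.
    code-unique : ∀ {f x s s′ a} → OnlyBelow f x s a → s ∈ K → s′ ∈ K → s′ ∈ x → s′ ≡ s
    code-unique only s∈K s′∈K s′∈x with only _ s′∈x
    ... | inj₁ s′≡s = s′≡s
    ... | inj₂ (inj₁ lab) = ⊥-elim (code-¬label (code _ s′∈K) lab)
    ... | inj₂ (inj₂ (_ , s″ , s″∈s′ , _ , _ , (_ , s″∈K , _) , _)) =
      ⊥-elim (code-∉ (code _ s′∈K) (code s″ s″∈K) s″∈s′)

    label-index : ∀ {f x s l a b} → OnlyBelow f x s a → s ∈ K → l ∈ x → Label l b → b ≡ a
    label-index only s∈K l∈x lab with only _ l∈x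
    ... | inj₁ refl = ⊥-elim (code-¬label (code _ s∈K) lab)
    ... | inj₂ (inj₁ lab′) = label-injective lab lab′
    ... | inj₂ (inj₂ (_ , s″ , s″∈l , _ , _ , (_ , s″∈K , _) , _)) =
      ⊥-elim (code-∉label (code s″ s″∈K) lab s″∈l)

    -- By ∈-induction on `a`: completeness matches each recursive element of one set with an element
    -- of the other at the same arguments, and the induction hypothesis identifies the two.
    attempt-unique : ∀ {f g} → Attempt f → Attempt g →
      ∀ a s x x′ → x ∈ f → x′ ∈ g → Indexed x s a → Indexed x′ s a → x ≡ x′
    attempt-unique {f} {g} att-f att-g = foundation
      (∀̇ (∀̇ (∀̇ (v1 ∈̇ v4 ⇒̇ v0 ∈̇ v5 ⇒̇ proj₁ (indexedᵇ v6 v1 v2 v3) ⇒̇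
        proj₁ (indexedᵇ v6 v0 v2 v3) ⇒̇ v1 ≐ v0)))) (f ∷ g ∷ K ∷ []) step
      where
      Unique : M → Set
      Unique a = ∀ s x x′ → x ∈ f → x′ ∈ g → Indexed x s a → Indexed x′ s a → x ≡ x′

      step : ∀ a → (∀ a′ → a′ ∈ a → Unique a′) → Unique a
      step a ih s x x′ x∈f x′∈g ix@(s∈x , s∈K , l , l∈x , lab)
                                ix′@(s∈x′ , _ , l′ , l′∈x′ , lab′) =
        extensionality x x′ λ y → mk⇔ (x⊆x′ y) (x′⊆x y)
        where
        cx = attempt-correct att-f x∈f ix
        cx′ = attempt-correct att-g x′∈g ix′

        x⊆x′ : ∀ y → y ∈ x → y ∈ x′
        x⊆x′ y y∈x with proj₁ cx y y∈x
        ... | inj₁ refl = s∈x′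
        ... | inj₂ (inj₁ lab-y) = subst (_∈ x′) (label-unique lab′ lab-y) l′∈x′
        ... | inj₂ (inj₂ (y∈f , s″ , _ , a″ , a″∈a , iy@(_ , s″∈K , _) , adj))
          with y′ , y′∈x′ , y′∈g , iy′ ← proj₂ cx′ a″ a″∈a s″ s″∈K adj
          = subst (_∈ x′) (sym (ih a″ a″∈a s″ y y′ y∈f y′∈g iy iy′)) y′∈x′

        x′⊆x : ∀ y → y ∈ x′ → y ∈ x
        x′⊆x y y∈x′ with proj₁ cx′ y y∈x′
        ... | inj₁ refl = s∈x
        ... | inj₂ (inj₁ lab-y) = subst (_∈ x) (label-unique lab lab-y) l∈x
        ... | inj₂ (inj₂ (y∈g , s″ , _ , a″ , a″∈a , iy@(_ , s″∈K , _) , adj))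
          with y′ , y′∈x , y′∈f , iy′ ← proj₂ cx a″ a″∈a s″ s″∈K adj
          = subst (_∈ x) (ih a″ a″∈a s″ y′ y y′∈f y∈g iy′ iy) y′∈x

    vertex : ∀ F a s → s ∈ K → ∃[ x ] Vertex F x s a
    vertex F a s s∈K
      with l , lab ← label a
      with d , d-spec ← separation (belowᵇ v4 v3 v0 v1 v2) (s ∷ a ∷ K ∷ W ∷ []) F
      with d₁ , s∈d₁ , d⊆d₁ , d₁-split ← adjunction d s
      with x , l∈x , d₁⊆x , x-split ← adjunction d₁ l
      = x , (d₁⊆x s s∈d₁ , s∈K , l , l∈x , lab) , only
      , λ y y∈F below → d₁⊆x y (d⊆d₁ y (from (d-spec y) (y∈F , below)))
      where
      only : OnlyBelow F x s a
      only y y∈x with x-split y y∈x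
      ... | inj₂ refl = inj₂ (inj₁ lab)
      ... | inj₁ y∈d₁ with d₁-split y y∈d₁
      ...   | inj₁ y∈d = inj₂ (inj₂ (to (d-spec y) y∈d))
      ...   | inj₂ y≡s = inj₁ y≡s

    attempt-mono : ∀ {f g x s a} → (∀ y → y ∈ f → y ∈ g) →
      OnlyBelow f x s a × Complete f x s a → OnlyBelow g x s a × Complete g x s a
    attempt-mono f⊆g (only , complete)
      = (λ y y∈x → map₂ (map₂ λ (y∈f , below) → f⊆g y y∈f , below) (only y y∈x))
      , λ a′ a′∈a s′ s′∈K adj →
          let y , y∈x , y∈f , iy = complete a′ a′∈a s′ s′∈K adj in y , y∈x , f⊆g y y∈f , iy

    attempt-union : ∀ {b F} → (∀ f → f ∈ b → Attempt f) →
                    (∀ x → x ∈ F ⇔ (∃[ f ] f ∈ b × x ∈ f)) → Attempt F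
    attempt-union all-att F-spec x x∈F s s∈x s∈K l l∈x t t∈l a a∈t lab
      with f , f∈b , x∈f ← to (F-spec x) x∈F
      = attempt-mono (λ y y∈f → from (F-spec y) (f , f∈b , y∈f))
          (all-att f f∈b x x∈f s s∈x s∈K l l∈x t t∈l a a∈t lab)

    -- The union `F` of collected attempts supplies the values below `a`, and `c` adds the values at
    -- `a`. Strong collection ensures that `b` has only attempts and `c` only vertices as elements.
    covers-step : ∀ a → (∀ a′ → a′ ∈ a → ∃[ f ] Covers f a′) → ∃[ f ] Covers f a
    covers-step a ih
      with b , b-total , b-only ← strong-collection
             (coversᵇ v3 v2 v0 v1) (coversᵇ v4 v3 v1 v0) (K ∷ W ∷ []) a (λ _ _ → refl) ih
      with F , F-spec ← union b
      with c , c-total , c-only ← strong-collection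
             (vertexᵇ v5 v4 v3 v0 v1 v2) (vertexᵇ v6 v5 v4 v1 v0 v3)
             (a ∷ F ∷ K ∷ W ∷ []) K (λ _ _ → refl) (vertex F a)
      with g , g-spec ← F ∪ c
      = g , attempt , λ s s∈K →
          let x , x∈c , ix , _ = c-total s s∈K in x , from (g-spec x) (inj₂ x∈c) , ix
      where
      F-attempt : Attempt F
      F-attempt = attempt-union (λ f f∈b → proj₁ (proj₂ (proj₂ (b-only f f∈b)))) F-spec

      F⊆g : ∀ y → y ∈ F → y ∈ g
      F⊆g y = from (g-spec y) ∘ inj₁

      attempt : Attempt g
      attempt x x∈g s s∈x s∈K l l∈x t t∈l a₁ a₁∈t lab with to (g-spec x) x∈g
      ... | inj₁ x∈F =
        attempt-mono F⊆g (F-attempt x x∈F s s∈x s∈K l l∈x t t∈l a₁ a₁∈t lab)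
      ... | inj₂ x∈c
        with s₀ , s₀∈K , _ , only , above ← c-only x x∈c
        -- The arguments read off from `x` are those from which it was built.
        with refl ← code-unique only s₀∈K s∈K s∈x
        with refl ← label-index only s₀∈K l∈x lab
        = attempt-mono F⊆g (only , λ a′ a′∈a s′ s′∈K adj →
            let f , f∈b , _ , f-covers = b-total a′ a′∈a
                y , y∈f , iy@(s′∈y , _) = f-covers s′ s′∈K
                y∈F = from (F-spec y) (f , f∈b , y∈f)
            in y , above y y∈F (s′ , s′∈y , a′ , a′∈a , iy , adj) , y∈F , iy)

    covers : ∀ a → ∃[ f ] Covers f a
    covers = foundation (∃̇ (proj₁ (coversᵇ v3 v2 v0 v1))) (K ∷ W ∷ []) covers-step

    abstract
      vertex-at : ∀ s a → s ∈ K → ∃[ x ] Indexed x s a × ∃[ f ] Attempt f × x ∈ f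
      vertex-at s a s∈K =
        let f , att , total = covers a
            x , x∈f , ix = total s s∈K
        in x , ix , f , att , x∈f

-- Codes of the vertices and the embedding

corollary27 : ExcludedMiddle 0ℓ →
    (M : Set) (_∈_ : Rel M 0ℓ) → IsKPModel _∈_ → Countable M →
    (G : Set) (_⇀_ : Rel G 0ℓ) → Countable G → Grading (_<ᴼ_ _∈_) _⇀_ →
    IsomorphicToSubmodel _⇀_ _∈_
corollary27 em M _∈_ kp _ G _⇀_ countable (α , α-mono) =
  (λ x → ∃[ v ] j v ≡ x) , (λ v → j v , v , refl) , record
    { isOrderMonomorphism = record
      { isOrderHomomorphism = record
        { cong = cong j
        ; mono = j-mono
        }
      ; injective = j-injective
      ; cancel = j-cancel
      }
    ; surjective = λ (_ , v , j-v≡x) → v , λ u≡v → trans (cong j u≡v) j-v≡x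
    }
  where
  open KP em _∈_ kp
  open Injection countable using () renaming (to to index; injective to index-injective)

  K = proj₁ codes

  K-code : ∀ s → s ∈ K → Code s
  K-code = proj₁ (proj₂ codes)

  open Recursion K K-code

  grade : G → M
  grade v = proj₁ (α v)

  -- `Codes` cuts this off after `index v`, so an arrow is recorded at its endpoint of larger index.
  -- The own index is included to be the greatest numeral of the code.
  Near : G → ℕ → Set
  Near v l = l ≡ index v ⊎ ∃[ u ] index u ≡ l × (u ⇀ v ⊎ v ⇀ u)

  code-of : ∀ v → ∃[ s ] s ∈ K × Codes (suc (index v)) (Near v) s
  code-of v = proj₂ (proj₂ codes) (Near v) (index v) (inj₁ refl)

  s : G → M
  s = proj₁ ∘ code-of

  s∈K : ∀ v → s v ∈ K
  s∈K = proj₁ ∘ proj₂ ∘ code-of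

  s-spec : ∀ v → Codes (suc (index v)) (Near v) (s v)
  s-spec = proj₂ ∘ proj₂ ∘ code-of

  own∈s : ∀ v → # (index v) ∈ s v
  own∈s v = from (s-spec v _) (inj₂ (index v , ≤-refl , inj₁ refl , refl))

  top-own : ∀ v → Top (# (index v)) (s v)
  top-own v z z∈s with to (s-spec v z) z∈s
  ... | inj₁ z≡W = inj₂ (inj₂ z≡W)
  ... | inj₂ (l , l<1+i , _ , refl) with m<1+n⇒m<n∨m≡n l<1+i
  ...   | inj₁ l<i = inj₁ (#-mono l<i)
  ...   | inj₂ refl = inj₂ (inj₁ refl)

  -- Equality is included because every `s v` is adjacent to itself.
  Linked : G → G → Set
  Linked v w = v ≡ w ⊎ v ⇀ w ⊎ w ⇀ v

  linked-sym : ∀ {v w} → Linked v w → Linked w v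
  linked-sym (inj₁ v≡w) = inj₁ (sym v≡w)
  linked-sym (inj₂ (inj₁ v⇀w)) = inj₂ (inj₂ v⇀w)
  linked-sym (inj₂ (inj₂ w⇀v)) = inj₂ (inj₁ w⇀v)

  top⇒own : ∀ {v m} → m ∈ s v → m ∈ W → Top m (s v) → m ≡ # (index v)
  top⇒own {v} {m} m∈s m∈W top with to (s-spec v m) m∈s | top _ (own∈s v)
  ... | inj₁ m≡W | _ = ⊥-elim (∈-irrefl m≡W m∈W)
  ... | inj₂ (_ , s≤s l≤i , _ , refl) | inj₁ i∈l = ⊥-elim (#-∈⇒≱ i∈l l≤i)
  ... | inj₂ _ | inj₂ (inj₁ i≡m) = sym i≡m
  ... | inj₂ _ | inj₂ (inj₂ i≡W) = ⊥-elim (#≢W (index v) i≡W)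

  own∈⇒linked : ∀ {v w} → # (index v) ∈ s w → Linked v w
  own∈⇒linked {v} {w} i∈s with to (s-spec w _) i∈s
  ... | inj₁ i≡W = ⊥-elim (#≢W (index v) i≡W)
  ... | inj₂ (l , _ , near , #i≡#l) with #-injective {index v} {l} #i≡#l | near
  ...   | refl | inj₁ i≡j = inj₁ (index-injective i≡j)
  ...   | refl | inj₂ (u , i≡j , arrow) with refl ← index-injective i≡j = inj₂ arrow

  adjacent⇒linked : ∀ {v w} → Adjacent (s v) (s w) → Linked v w
  adjacent⇒linked (m , m∈sv , m∈sw , m∈W , inj₁ top)
    with refl ← top⇒own m∈sv m∈W top = own∈⇒linked m∈sw
  adjacent⇒linked (m , m∈sv , m∈sw , m∈W , inj₂ top)
    with refl ← top⇒own m∈sw m∈W top = linked-sym (own∈⇒linked m∈sv)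

  ⇀⇒adjacent : ∀ {v w} → v ⇀ w → Adjacent (s v) (s w)
  ⇀⇒adjacent {v} {w} v⇀w with ≤-total (index v) (index w)
  ... | inj₁ i≤j = # (index v) , own∈s v
    , from (s-spec w _) (inj₂ (index v , s≤s i≤j , inj₂ (v , refl , inj₁ v⇀w) , refl))
    , proj₂ (num (index v)) , inj₁ (top-own v)
  ... | inj₂ j≤i = # (index w)
    , from (s-spec v _) (inj₂ (index w , s≤s j≤i , inj₂ (w , refl , inj₂ v⇀w) , refl))
    , own∈s w , proj₂ (num (index w)) , inj₂ (top-own w)

  -- The embedding `j`

  at : ∀ v → ∃[ x ] Indexed x (s v) (grade v) × ∃[ f ] Attempt f × x ∈ f
  at v = vertex-at (s v) (grade v) (s∈K v)

  j : G → M
  j = proj₁ ∘ at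

  j-indexed : ∀ v → Indexed (j v) (s v) (grade v)
  j-indexed v = proj₁ (proj₂ (at v))

  only-below : ∀ v → OnlyBelow (proj₁ (proj₂ (proj₂ (at v)))) (j v) (s v) (grade v)
  only-below v = let _ , ix , _ , att , x∈f = at v in proj₁ (attempt-correct att x∈f ix)

  j-mono : ∀ {v w} → v ⇀ w → j v ∈ j w
  j-mono {v} {w} v⇀w =
    let x , ix , f , att , x∈f = at v
        x′ , ix′ , f′ , att′ , x′∈f′ = at w
        y , y∈x′ , y∈f′ , iy = proj₂ (attempt-correct att′ x′∈f′ ix′)
                                 (grade v) (α-mono v⇀w) (s v) (s∈K v) (⇀⇒adjacent v⇀w)
    -- The two vertices come with different attempts; uniqueness identifies the value found inside
    -- `j w` with `j v`.
    in subst (_∈ x′) (attempt-unique att′ att _ _ y x y∈f′ x∈f iy ix) y∈x′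

  -- Equal images contain the same code, so `v` and `w` are linked; an arrow between them would give
  -- `j v ∈ j v`.
  j-injective : ∀ {v w} → j v ≡ j w → v ≡ w
  j-injective {v} {w} jv≡jw = [ id , ⊥-elim ∘ unequal ]′ (own∈⇒linked i∈sw)
    where
    sv≡sw : s v ≡ s w
    sv≡sw = code-unique (only-below w) (s∈K w) (s∈K v)
              (subst (s v ∈_) jv≡jw (proj₁ (j-indexed v)))

    i∈sw : # (index v) ∈ s w
    i∈sw = subst (# (index v) ∈_) sv≡sw (own∈s v)

    unequal : ¬ (v ⇀ w ⊎ w ⇀ v)
    unequal (inj₁ v⇀w) = ∈-irrefl jv≡jw (j-mono v⇀w)
    unequal (inj₂ w⇀v) = ∈-irrefl (sym jv≡jw) (j-mono w⇀v)

  -- Since `j v` contains a code, it is neither a code nor a label, hence a recursive value in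
  -- `j w`, and `v` and `w` are linked. The reverse arrow would give `j w ∈ j v`, against
  -- foundation.
  j-cancel : ∀ {v w} → j v ∈ j w → v ⇀ w
  j-cancel {v} {w} jv∈jw with only-below w (j v) jv∈jw
  ... | inj₁ jv≡sw = ⊥-elim (code-∉ (K-code _ (s∈K w)) (K-code _ (s∈K v))
                       (subst (s v ∈_) jv≡sw (proj₁ (j-indexed v))))
  ... | inj₂ (inj₁ lab) =
    ⊥-elim (code-∉label (K-code _ (s∈K v)) lab (proj₁ (j-indexed v)))
  ... | inj₂ (inj₂ (_ , s′ , s′∈jv , a′ , a′∈a , (_ , s′∈K , _) , adj))
    with refl ← code-unique (only-below v) (s∈K v) s′∈K s′∈jv
    with adjacent⇒linked {v} {w} adj
  ...   | inj₁ refl = ⊥-elim (∈-irrefl refl jv∈jw)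
  ...   | inj₂ (inj₁ v⇀w) = v⇀w
  ...   | inj₂ (inj₂ w⇀v) = ⊥-elim (∈-asym _ _ jv∈jw (j-mono w⇀v))
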